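{- In $\mathcal A$ we have $$S_{\mathcal A}(1)=\zeta^{(2)}_{\mathcal A}(1)=-\mathtt{q}_2,\qquad \zeta^{(2)}_{\mathcal A}(\bar1)=S_{\mathcal A}(\bar1)=-\tfrac12\mathtt{q}_2,$$ $$t_{\mathcal A}(1)=T_{\mathcal A}(1)=\mathtt{q}_2,\qquad t_{\mathcal A}(\bar1)=T_{\mathcal A}(\bar1)=-\tfrac12(-1)^{p'}\mathtt{q}_2.$$
   Context: Let $\mathcal{P}$ be the set of primes and $\mathcal{A}=\prod_{p\in\mathcal P}(\mathbb{Z}/p\mathbb{Z})\big/\bigoplus_{p\in\mathcal P}(\mathbb{Z}/p\mathbb{Z})$; two families of residues are equal in $\mathcal A$ iff they agree for all but finitely many $p$. $\mathtt{q}_2=\big((2^{p-1}-1)/p\bmod p\big)_{p>2}\in\mathcal A$, and $(-1)^{p'}$ denotes $\big((-1)^{(p-1)/2}\big)_{p\ge3}\in\mathcal A$. Depth one values, as elements of $\mathcal A$ (each sum taken mod $p$): $$S_{\mathcal A}(1)=\zeta^{(2)}_{\mathcal A}(1)=\Big(\sum_{0<k<p,\ 2\mid k}\tfrac1k\Big)_p,\qquad S_{\mathcal A}(\bar1)=\zeta^{(2)}_{\mathcal A}(\bar1)=\Big(\sum_{0<k<p,\ 2\mid k}\tfrac{(-1)^{k/2}}k\Big)_p,$$ $$t_{\mathcal A}(1)=T_{\mathcal A}(1)=\Big(\sum_{0<k<p,\ 2\nmid k}\tfrac1k\Big)_p,\qquad t_{\mathcal A}(\bar1)=T_{\mathcal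 A}(\bar1)=\Big(\sum_{0<k<p,\ 2\nmid k}\tfrac{(-1)^{(k+1)/2}}k\Big)_p.$$ -}

module Defs where

open import Algebra.Bundles using (CommutativeRing)
open import Data.Integer using (ℤ; +_; -1ℤ; 0ℤ; 1ℤ; _+_; _*_; _-_; -_; _^_)
open import Data.Integer.Divisibility.Signed
  using (_∣_; divides; ∣m∣n⇒∣m+n; ∣m⇒∣-m; ∣m⇒∣m*n; ∣n⇒∣m*n)
import Data.Integer.Properties as ℤ
open import Data.Integer.Solver using (module +-*-Solver)
open import Data.Irrelevant using ([_])
open import Data.List using (List; []; _++_; applyUpTo; filter; foldr; map)
open import Data.List.Membership.Propositional using (_∉_)
open import Data.List.Membership.Propositional.Properties using (∈-++⁺ˡ; ∈-++⁺ʳ)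
open import Data.Nat as ℕ using (ℕ; suc; _∸_)
import Data.Nat.Divisibility as ℕ
open import Data.Nat.Coprimality using (Coprime; coprime⇒gcd≡1)
open import Data.Nat.DivMod using (_/_)
open import Data.Nat.GCD using (gcd; gcd-GCD; module Bézout)
open import Data.Nat.Primality using (Prime; prime⇒nonZero)
open import Data.Product using (∃; _,_)
open import Data.Rational using (ℚ; ↥_; ↧ₙ_)
open import Data.Refinement using (Refinement-syntax; _,_; value)
open import Function using (_∘_)
open import Level using (0ℓ)
open import Relation.Binary.PropositionalEquality
  using (_≡_; refl; cong; subst; module ≡-Reasoning)
open import Relation.Nullary.Decidable using (¬?)
open import Relation.Unary using (Pred; Decidable)

open Bézout using (Identity; identity; +-; -+)

-- Residues are represented by integers; equality in ℤ/n is congruence.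

infix 4 _≡_mod_

_≡_mod_ : ℤ → ℤ → ℕ → Set
x ≡ y mod n = + n ∣ x - y

private
  ≡⇒mod : ∀ n {x y} → x ≡ y → x ≡ y mod n
  ≡⇒mod n {x} refl = divides 0ℤ (ℤ.+-inverseʳ x)

  mod-sym : ∀ n {x y} → x ≡ y mod n → y ≡ x mod n
  mod-sym n {x} {y} d = subst (+ n ∣_) (lemma x y) (∣m⇒∣-m d)
    where
    open +-*-Solver
    lemma : ∀ x y → - (x - y) ≡ y - x
    lemma = solve 2 (λ x y → :- (x :- y) := y :- x) refl

  mod-trans : ∀ n {x y z} → x ≡ y mod n → y ≡ z mod n → x ≡ z mod n
  mod-trans n {x} {y} {z} d e = subst (+ n ∣_) (lemma x y z) (∣m∣n⇒∣m+n d e)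
    where
    open +-*-Solver
    lemma : ∀ x y z → (x - y) + (y - z) ≡ x - z
    lemma = solve 3 (λ x y z → (x :- y) :+ (y :- z) := x :- z) refl

  +-cong-mod : ∀ n {x y u v} → x ≡ y mod n → u ≡ v mod n → x + u ≡ y + v mod n
  +-cong-mod n {x} {y} {u} {v} d e =
    subst (+ n ∣_) (lemma x y u v) (∣m∣n⇒∣m+n d e)
    where
    open +-*-Solver
    lemma : ∀ x y u v → (x - y) + (u - v) ≡ (x + u) - (y + v)
    lemma = solve 4 (λ x y u v → (x :- y) :+ (u :- v) := (x :+ u) :- (y :+ v)) refl

  *-cong-mod : ∀ n {x y u v} → x ≡ y mod n → u ≡ v mod n → x * u ≡ y * v mod n
  *-cong-mod n {x} {y} {u} {v} d e =
    subst (+ n ∣_) (lemma x y u v) (∣m∣n⇒∣m+n (∣m⇒∣m*n u d) (∣n⇒∣m*n y e))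
    where
    open +-*-Solver
    lemma : ∀ x y u v → (x - y) * u + y * (u - v) ≡ x * u - y * v
    lemma = solve 4 (λ x y u v →
      (x :- y) :* u :+ y :* (u :- v) := x :* u :- y :* v) refl

  neg-cong-mod : ∀ n {x y} → x ≡ y mod n → - x ≡ - y mod n
  neg-cong-mod n {x} {y} d = subst (+ n ∣_) (lemma x y) (∣m⇒∣-m d)
    where
    open +-*-Solver
    lemma : ∀ x y → - (x - y) ≡ - x - - y
    lemma = solve 2 (λ x y → :- (x :- y) := :- x :- :- y) refl

ℤ/ : ℕ → CommutativeRing 0ℓ 0ℓ
ℤ/ n = record
  { Carrier = ℤ
  ; _≈_ = λ x y → x ≡ y mod n
  ; _+_ = _+_
  ; _*_ = _*_
  ; -_ = -_
  ; 0# = 0ℤ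
  ; 1# = 1ℤ
  ; isCommutativeRing = record
    { isRing = record
      { +-isAbelianGroup = record
        { isGroup = record
          { isMonoid = record
            { isSemigroup = record
              { isMagma = record
                { isEquivalence = record
                  { refl = λ {x} → ≡⇒mod n {x} refl
                  ; sym = λ {x} {y} → mod-sym n {x} {y}
                  ; trans = λ {x} {y} {z} → mod-trans n {x} {y} {z}
                  }
                ; ∙-cong = λ {x} {y} {u} {v} → +-cong-mod n {x} {y} {u} {v}
                }
              ; assoc = λ x y z → ≡⇒mod n (ℤ.+-assoc x y z)
              }
            ; identity = (λ x → ≡⇒mod n (ℤ.+-identityˡ x))
                       , (λ x → ≡⇒mod n (ℤ.+-identityʳ x))
            }
          ; inverse = (λ x → ≡⇒mod n (ℤ.+-inverseˡ x))
                    , (λ x → ≡⇒mod n (ℤ.+-inverseʳ x))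
          ; ⁻¹-cong = λ {x} {y} → neg-cong-mod n {x} {y}
          }
        ; comm = λ x y → ≡⇒mod n (ℤ.+-comm x y)
        }
      ; *-cong = λ {x} {y} {u} {v} → *-cong-mod n {x} {y} {u} {v}
      ; *-assoc = λ x y z → ≡⇒mod n (ℤ.*-assoc x y z)
      ; *-identity = (λ x → ≡⇒mod n (ℤ.*-identityˡ x))
                   , (λ x → ≡⇒mod n (ℤ.*-identityʳ x))
      ; distrib = (λ x y z → ≡⇒mod n (ℤ.*-distribˡ-+ x y z))
                , (λ x y z → ≡⇒mod n (ℤ.*-distribʳ-+ x y z))
      }
    ; *-comm = λ x y → ≡⇒mod n (ℤ.*-comm x y)
    }
  }

𝒫 : Set
𝒫 = [ p ∈ ℕ ∣ Prime p ]

-- ∏ R / ⊕ R: families are identified when they agree outside a finite list of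
-- primes.

∏/⊕ : (𝒫 → CommutativeRing 0ℓ 0ℓ) → CommutativeRing 0ℓ 0ℓ
∏/⊕ R = record
  { Carrier = ∀ p → R.Carrier p
  ; _≈_ = λ x y → ∃ λ (ps : List ℕ) → ∀ p → value p ∉ ps → R._≈_ p (x p) (y p)
  ; _+_ = λ x y p → R._+_ p (x p) (y p)
  ; _*_ = λ x y p → R._*_ p (x p) (y p)
  ; -_ = λ x p → R.-_ p (x p)
  ; 0# = R.0#
  ; 1# = R.1#
  ; isCommutativeRing = record
    { isRing = record
      { +-isAbelianGroup = record
        { isGroup = record
          { isMonoid = record
            { isSemigroup = record
              { isMagma = record
                { isEquivalence = record
                  { refl = [] , λ p _ → R.refl p
                  ; sym = λ (ps , e) → ps , λ p p∉ → R.sym p (e p p∉)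
                  ; trans = both (λ p → R.trans p)
                  }
                ; ∙-cong = both (λ p → R.+-cong p)
                }
              ; assoc = λ x y z → [] , λ p _ → R.+-assoc p (x p) (y p) (z p)
              }
            ; identity = (λ x → [] , λ p _ → R.+-identityˡ p (x p))
                       , (λ x → [] , λ p _ → R.+-identityʳ p (x p))
            }
          ; inverse = (λ x → [] , λ p _ → R.-‿inverseˡ p (x p))
                    , (λ x → [] , λ p _ → R.-‿inverseʳ p (x p))
          ; ⁻¹-cong = λ (ps , e) → ps , λ p p∉ → R.-‿cong p (e p p∉)
          }
        ; comm = λ x y → [] , λ p _ → R.+-comm p (x p) (y p)
        }
      ; *-cong = both (λ p → R.*-cong p)
      ; *-assoc = λ x y z → [] , λ p _ → R.*-assoc p (x p) (y p) (z p)
      ; *-identity = (λ x → [] , λ p _ → R.*-identityˡ p (x p))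
                   , (λ x → [] , λ p _ → R.*-identityʳ p (x p))
      ; distrib = (λ x y z → [] , λ p _ → R.distribˡ p (x p) (y p) (z p))
                , (λ x y z → [] , λ p _ → R.distribʳ p (x p) (y p) (z p))
      }
    ; *-comm = λ x y → [] , λ p _ → R.*-comm p (x p) (y p)
    }
  }
  where
  module R p = CommutativeRing (R p)

  both : {P Q S : 𝒫 → Set} → (∀ p → P p → Q p → S p) →
         ∃ (λ (ps : List ℕ) → ∀ p → value p ∉ ps → P p) →
         ∃ (λ (ps : List ℕ) → ∀ p → value p ∉ ps → Q p) →
         ∃ (λ (ps : List ℕ) → ∀ p → value p ∉ ps → S p)
  both f (ps , d) (qs , e) = ps ++ qs , λ p p∉ →
    f p (d p (p∉ ∘ ∈-++⁺ˡ)) (e p (p∉ ∘ ∈-++⁺ʳ ps))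

𝒜 : CommutativeRing 0ℓ 0ℓ
𝒜 = ∏/⊕ (λ p → ℤ/ (value p))

-- The coefficient of k in Bézout's identity for gcd k n. By recip-inverse it
-- is the inverse of k in ℤ/n whenever k and n are coprime; no other value of
-- it matters up to finitely many primes.

recip : ℕ → ℕ → ℤ
recip n k with identity (gcd-GCD k n)
... | +- x _ _ = + x
... | -+ x _ _ = - + x

recip-inverse : ∀ {n k} → Coprime k n → + k * recip n k ≡ 1ℤ mod n
recip-inverse {n} {k} c with identity (gcd-GCD k n)
... | +- x y eq = divides (+ y) (begin
  + k * + x - 1ℤ                ≡⟨ cong (_- 1ℤ) (ℤ.*-comm (+ k) (+ x)) ⟩
  + x * + k - 1ℤ                ≡⟨ cong (_- 1ℤ) (ℤ.pos-* x k) ⟨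
  + (x ℕ.* k) - 1ℤ              ≡⟨ cong (λ m → + m - 1ℤ) eq ⟨
  + (gcd k n ℕ.+ y ℕ.* n) - 1ℤ  ≡⟨ cong (λ d → + (d ℕ.+ y ℕ.* n) - 1ℤ) (coprime⇒gcd≡1 c) ⟩
  + (1 ℕ.+ y ℕ.* n) - 1ℤ        ≡⟨ cong (_- 1ℤ) (ℤ.pos-+ 1 (y ℕ.* n)) ⟩
  (1ℤ + + (y ℕ.* n)) - 1ℤ       ≡⟨ lemma (+ (y ℕ.* n)) ⟩
  + (y ℕ.* n)                   ≡⟨ ℤ.pos-* y n ⟩
  + y * + n                     ∎)
  where
  open ≡-Reasoning
  lemma : ∀ a → (1ℤ + a) - 1ℤ ≡ a
  lemma = solve 1 (λ a → (con 1ℤ :+ a) :- con 1ℤ := a) refl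
    where open +-*-Solver
... | -+ x y eq = divides (- + y) (begin
  + k * (- + x) - 1ℤ            ≡⟨ lemma (+ k) (+ x) ⟩
  - (1ℤ + + x * + k)            ≡⟨ cong (λ m → - (1ℤ + m)) (ℤ.pos-* x k) ⟨
  - + (1 ℕ.+ x ℕ.* k)           ≡⟨ cong (λ d → - + (d ℕ.+ x ℕ.* k)) (coprime⇒gcd≡1 c) ⟨
  - + (gcd k n ℕ.+ x ℕ.* k)     ≡⟨ cong (λ m → - + m) eq ⟩
  - + (y ℕ.* n)                 ≡⟨ cong -_ (ℤ.pos-* y n) ⟩
  - (+ y * + n)                 ≡⟨ ℤ.neg-distribˡ-* (+ y) (+ n) ⟩
  (- + y) * + n                 ∎)
  where
  open ≡-Reasoning
  lemma : ∀ a b → a * (- b) - 1ℤ ≡ - (1ℤ + b * a)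
  lemma = solve 2 (λ a b → a :* (:- b) :- con 1ℤ := :- (con 1ℤ :+ b :* a)) refl
    where open +-*-Solver

-- The ℚ-algebra structure of 𝒜: q is reduced mod p at every prime p not
-- dividing its denominator.

fromℚ : ℚ → CommutativeRing.Carrier 𝒜
fromℚ q p = (↥ q) * recip (value p) (↧ₙ q)

-- ∑< p P? f is the sum of f k over 0 < k < p satisfying P.

∑< : ∀ {P : Pred ℕ 0ℓ} → ℕ → Decidable P → (ℕ → ℤ) → ℤ
∑< p P? f = foldr _+_ 0ℤ (map f (filter P? (applyUpTo suc (p ∸ 1))))

2∣? : Decidable (2 ℕ.∣_)
2∣? = 2 ℕ.∣?_

-- The division by p is exact for p > 2; the component at 2 is irrelevant.

q₂ : CommutativeRing.Carrier 𝒜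
q₂ (p , [ pr ]) = + (_/_ (2 ℕ.^ (p ∸ 1) ∸ 1) p {{prime⇒nonZero pr}})

[-1]^p′ : CommutativeRing.Carrier 𝒜
[-1]^p′ p = -1ℤ ^ ((value p ∸ 1) / 2)

-- The suffix 1̄ marks the alternating value. In depth one ζ⁽²⁾ and S are given
-- by the same sums, and so are t and T.

ζ⁽²⁾[1] ζ⁽²⁾[1̄] S[1] S[1̄] t[1] t[1̄] T[1] T[1̄] : CommutativeRing.Carrier 𝒜

ζ⁽²⁾[1] p = ∑< (value p) 2∣? (λ k → recip (value p) k)
ζ⁽²⁾[1̄] p = ∑< (value p) 2∣? (λ k → -1ℤ ^ (k / 2) * recip (value p) k)

S[1] p = ∑< (value p) 2∣? (λ k → recip (value p) k)
S[1̄] p = ∑< (value p) 2∣? (λ k → -1ℤ ^ (k / 2) * recip (value p) k)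

t[1] p = ∑< (value p) (¬? ∘ 2∣?) (λ k → recip (value p) k)
t[1̄] p = ∑< (value p) (¬? ∘ 2∣?) (λ k → -1ℤ ^ (suc k / 2) * recip (value p) k)

T[1] p = ∑< (value p) (¬? ∘ 2∣?) (λ k → recip (value p) k)
T[1̄] p = ∑< (value p) (¬? ∘ 2∣?) (λ k → -1ℤ ^ (suc k / 2) * recip (value p) k)

{-# OPTIONS --safe #-}
-- For s = ±1 put (1 + √s)ⁿ = E n + O n √s, so that E and O are binomial sums
-- over even and odd k with weights s^⌊k/2⌋.  For an odd prime p and 0 < k < p,
-- C(p,k)/p is congruent to (-1)^(k-1)/k mod p, hence each of the four sums is,
-- up to sign, E p or O p without its end terms, divided by p.  For s = 1 both
-- E p and O p equal 2^(p-1).  For s = -1 one has (E p)² = 2^(p-1) and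
-- O p = (-1)^((p-1)/2) E p, so that E p = 1 + p r with q₂ ≡ 2 r mod p.
module Submission where

open import Defs
open import Algebra.Bundles using (CommutativeRing)
open import Data.Integer using (ℤ; +_; -1ℤ; 0ℤ; 1ℤ)
import Data.Integer.Divisibility.Signed as ℤ∣
import Data.Integer.Properties as ℤ
open import Data.Integer.Solver using (module +-*-Solver)
open import Data.Irrelevant using ([_])
open import Data.List using ([]; _∷_; applyUpTo; filter; foldr; map)
open import Data.List.Membership.Propositional using (_∉_)
open import Data.List.Relation.Unary.Any using (here)
open import Data.Nat as ℕ using (ℕ; zero; suc; _<_; _≤_; z<s; s<s)
open import Data.Nat.Combinatorics
  using (_C_; nC1≡n; nCn≡1; k>n⇒nCk≡0; nCk+nC[k+1]≡[n+1]C[k+1])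
open import Data.Nat.Coprimality using (Coprime; prime⇒coprime; coprime-divisor)
  renaming (sym to coprime-sym)
open import Data.Nat.DivMod using (_/_; m*n/n≡m; m/n*n≡m)
open import Data.Nat.Divisibility using (_∣_; divides)
open import Data.Nat.Primality using (Prime; prime?; prime⇒irreducible; ¬prime[1])
import Data.Nat.Properties as ℕ
open import Data.Nat.Solver using () renaming (module +-*-Solver to ℕ-Solver)
open import Data.Product using (_×_; _,_; ∃)
open import Data.Rational using (½) renaming (-_ to -ℚ_)
open import Data.Refinement using (_,_; value)
open import Data.Sum using (_⊎_; inj₁; inj₂)
open import Function using (_∘_)
open import Level using (0ℓ)
open import Relation.Binary.PropositionalEquality
  using (_≡_; _≢_; refl; sym; trans; cong; cong₂; subst; module ≡-Reasoning)
open import Relation.Nullary using (¬_; yes; no; recompute; contradiction)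
open import Relation.Nullary.Decidable using (¬?)
open import Relation.Unary using (Pred; Decidable)

-- Qualified, because the unqualified operators are those of 𝒜.
module Z where
  open import Data.Integer public using (_+_; _*_; _-_; -_; _^_)

open CommutativeRing 𝒜 using (_≈_; _*_; -_)

-- Parity and powers of -1.

even⊎odd : ∀ n → (∃ λ j → n ≡ j ℕ.* 2) ⊎ (∃ λ j → n ≡ suc (j ℕ.* 2))
even⊎odd zero = inj₁ (0 , refl)
even⊎odd (suc n) with even⊎odd n
... | inj₁ (j , eq) = inj₂ (j , cong suc eq)
... | inj₂ (j , eq) = inj₁ (suc j , cong suc eq)

2∤⇒odd : ∀ n → ¬ 2 ∣ n → ∃ λ j → n ≡ suc (j ℕ.* 2)
2∤⇒odd n 2∤n with even⊎odd n
... | inj₁ (j , eq) = contradiction (divides j eq) 2∤n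
... | inj₂ odd = odd

-1^even : ∀ j → -1ℤ Z.^ (j ℕ.* 2) ≡ 1ℤ
-1^even zero = refl
-1^even (suc j) = cong (λ x → -1ℤ Z.* (-1ℤ Z.* x)) (-1^even j)

-1^n*-1^n : ∀ n → -1ℤ Z.^ n Z.* -1ℤ Z.^ n ≡ 1ℤ
-1^n*-1^n zero = refl
-1^n*-1^n (suc n) = trans (lemma (-1ℤ Z.^ n)) (-1^n*-1^n n)
  where
  open +-*-Solver
  lemma : ∀ x → (-1ℤ Z.* x) Z.* (-1ℤ Z.* x) ≡ x Z.* x
  lemma = solve 1 (λ x → (con -1ℤ :* x) :* (con -1ℤ :* x) := x :* x) refl

-- Finite sums over an initial segment.

∑ : ℕ → (ℕ → ℤ) → ℤ
∑ zero    f = 0ℤ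
∑ (suc n) f = f 0 Z.+ ∑ n (f ∘ suc)

∑-cong : ∀ n {f g} → (∀ {i} → i < n → f i ≡ g i) → ∑ n f ≡ ∑ n g
∑-cong zero    f≡g = refl
∑-cong (suc n) f≡g = cong₂ Z._+_ (f≡g z<s) (∑-cong n (f≡g ∘ s<s))

∑-last : ∀ n f → ∑ (suc n) f ≡ ∑ n f Z.+ f n
∑-last zero    f = ℤ.+-comm (f 0) 0ℤ
∑-last (suc n) f = trans (cong (f 0 Z.+_) (∑-last n (f ∘ suc)))
  (sym (ℤ.+-assoc (f 0) (∑ n (f ∘ suc)) (f (suc n))))

∑-+ : ∀ n f g → ∑ n (λ i → f i Z.+ g i) ≡ ∑ n f Z.+ ∑ n g
∑-+ zero    f g = refl
∑-+ (suc n) f g = trans (cong (f 0 Z.+ g 0 Z.+_) (∑-+ n (f ∘ suc) (g ∘ suc)))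
  (lemma (f 0) (g 0) (∑ n (f ∘ suc)) (∑ n (g ∘ suc)))
  where
  open +-*-Solver
  lemma : ∀ a b c d → (a Z.+ b) Z.+ (c Z.+ d) ≡ (a Z.+ c) Z.+ (b Z.+ d)
  lemma = solve 4 (λ a b c d → (a :+ b) :+ (c :+ d) := (a :+ c) :+ (b :+ d)) refl

∑-* : ∀ n a f → ∑ n (λ i → a Z.* f i) ≡ a Z.* ∑ n f
∑-* zero    a f = sym (ℤ.*-zeroʳ a)
∑-* (suc n) a f = trans (cong (a Z.* f 0 Z.+_) (∑-* n a (f ∘ suc)))
  (sym (ℤ.*-distribˡ-+ a (f 0) (∑ n (f ∘ suc))))

-- Removes the filter: `g` is zero at the rejected indices, so they may stay in the sum. On the
-- accepted ones a congruence suffices, asked only for `i < n` because reciprocals mod p are used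
-- only at 0 < k < p.
∑-filter : ∀ {P : Pred ℕ 0ℓ} (P? : Decidable P) p f g h n →
           (∀ {i} → i < n → P (h i) → f (h i) ≡ g i mod p) →
           (∀ i → ¬ P (h i) → g i ≡ 0ℤ) →
           foldr Z._+_ 0ℤ (map f (filter P? (applyUpTo h n))) ≡ ∑ n g mod p
∑-filter P? p f g h zero    on off = CommutativeRing.refl (ℤ/ p) {0ℤ}
∑-filter P? p f g h (suc n) on off
  with P? (h 0) | ∑-filter P? p f (g ∘ suc) (h ∘ suc) n (on ∘ s<s) (off ∘ suc)
... | yes P0 | ih = CommutativeRing.+-cong (ℤ/ p)
  {f (h 0)} {g 0} {foldr Z._+_ 0ℤ (map f (filter P? (applyUpTo (h ∘ suc) n)))}
  {∑ n (g ∘ suc)} (on z<s P0) ih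
... | no ¬P0 | ih =
  subst (λ x → foldr Z._+_ 0ℤ (map f (filter P? (applyUpTo (h ∘ suc) n))) ≡ x mod p)
    (sym (trans (cong (Z._+ ∑ n (g ∘ suc)) (off 0 ¬P0)) (ℤ.+-identityˡ (∑ n (g ∘ suc))))) ih

-- Binomial coefficients and weighted binomial sums.

[1+k]*[1+n]C[1+k]≡[1+n]*nCk : ∀ n k → suc k ℕ.* (suc n C suc k) ≡ suc n ℕ.* (n C k)
[1+k]*[1+n]C[1+k]≡[1+n]*nCk n zero = begin
  1 ℕ.* (suc n C 1) ≡⟨ ℕ.*-identityˡ (suc n C 1) ⟩
  suc n C 1         ≡⟨ nC1≡n (suc n) ⟩
  suc n             ≡⟨ ℕ.*-identityʳ (suc n) ⟨
  suc n ℕ.* 1       ∎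
  where open ≡-Reasoning
[1+k]*[1+n]C[1+k]≡[1+n]*nCk zero (suc k) = begin
  suc (suc k) ℕ.* (1 C suc (suc k)) ≡⟨ cong (suc (suc k) ℕ.*_) (k>n⇒nCk≡0 {1} {suc (suc k)} (s<s z<s)) ⟩
  suc (suc k) ℕ.* 0                 ≡⟨ ℕ.*-zeroʳ (suc (suc k)) ⟩
  1 ℕ.* 0                           ≡⟨ cong (1 ℕ.*_) (k>n⇒nCk≡0 {0} {suc k} z<s) ⟨
  1 ℕ.* (0 C suc k)                 ∎
  where open ≡-Reasoning
[1+k]*[1+n]C[1+k]≡[1+n]*nCk (suc n) (suc k) = begin
  suc (suc k) ℕ.* (suc (suc n) C suc (suc k))
    ≡⟨ cong (suc (suc k) ℕ.*_) (nCk+nC[k+1]≡[n+1]C[k+1] (suc n) (suc k)) ⟨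
  suc (suc k) ℕ.* (y ℕ.+ z)
    ≡⟨ split (suc k) y z ⟩
  y ℕ.+ (suc k ℕ.* y ℕ.+ suc (suc k) ℕ.* z)
    ≡⟨ cong₂ (λ u v → y ℕ.+ (u ℕ.+ v)) ([1+k]*[1+n]C[1+k]≡[1+n]*nCk n k)
         ([1+k]*[1+n]C[1+k]≡[1+n]*nCk n (suc k)) ⟩
  y ℕ.+ (suc n ℕ.* (n C k) ℕ.+ suc n ℕ.* (n C suc k))
    ≡⟨ cong (y ℕ.+_) (ℕ.*-distribˡ-+ (suc n) (n C k) (n C suc k)) ⟨
  y ℕ.+ suc n ℕ.* (n C k ℕ.+ n C suc k)
    ≡⟨ cong (λ u → y ℕ.+ suc n ℕ.* u) (nCk+nC[k+1]≡[n+1]C[k+1] n k) ⟩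
  suc (suc n) ℕ.* y ∎
  where
  open ≡-Reasoning
  y = suc n C suc k
  z = suc n C suc (suc k)
  split : ∀ a y z → suc a ℕ.* (y ℕ.+ z) ≡ y ℕ.+ (a ℕ.* y ℕ.+ suc a ℕ.* z)
  split = solve 3 (λ a y z →
    (con 1 :+ a) :* (y :+ z) := y :+ (a :* y :+ (con 1 :+ a) :* z)) refl
    where open ℕ-Solver

-- The value on (1 + X)ⁿ of the linear functional sending X^k to `w k`.
∑C : (ℕ → ℤ) → ℕ → ℤ
∑C w n = ∑ (suc n) (λ k → w k Z.* + (n C k))

∑C-* : ∀ a w n → ∑C (λ k → a Z.* w k) n ≡ a Z.* ∑C w n
∑C-* a w n = trans
  (∑-cong (suc n) (λ {k} _ → ℤ.*-assoc a (w k) (+ (n C k))))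
  (∑-* (suc n) a (λ k → w k Z.* + (n C k)))

-- Pascal's rule, that is, multiplication by 1 + X: the factor X shifts the weights by one.
∑C-suc : ∀ w n → ∑C w (suc n) ≡ ∑C w n Z.+ ∑C (w ∘ suc) n
∑C-suc w n = begin
  w₀ Z.+ ∑ (suc n) (λ k → w (suc k) Z.* + (suc n C suc k))
    ≡⟨ cong (w₀ Z.+_) (∑-cong (suc n) (λ {k} _ → pascal k)) ⟩
  w₀ Z.+ ∑ (suc n) (λ k → w (suc k) Z.* + (n C k) Z.+ w (suc k) Z.* + (n C suc k))
    ≡⟨ cong (w₀ Z.+_) (∑-+ (suc n) (λ k → w (suc k) Z.* + (n C k)) g) ⟩
  w₀ Z.+ (∑C (w ∘ suc) n Z.+ ∑ (suc n) g)
    -- The top term carries C(n, n+1) = 0; without it, `w₀` and the rest of the sum make up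
    -- `∑C w n`.
    ≡⟨ cong (λ x → w₀ Z.+ (∑C (w ∘ suc) n Z.+ x)) last≡0 ⟩
  w₀ Z.+ (∑C (w ∘ suc) n Z.+ ∑ n g)
    ≡⟨ swap w₀ (∑C (w ∘ suc) n) (∑ n g) ⟩
  w₀ Z.+ ∑ n g Z.+ ∑C (w ∘ suc) n ∎
  where
  open ≡-Reasoning
  open +-*-Solver
  w₀ = w 0 Z.* 1ℤ
  g = λ k → w (suc k) Z.* + (n C suc k)
  pascal : ∀ k → w (suc k) Z.* + (suc n C suc k) ≡
                 w (suc k) Z.* + (n C k) Z.+ w (suc k) Z.* + (n C suc k)
  pascal k = begin
    w (suc k) Z.* + (suc n C suc k)
      ≡⟨ cong (λ x → w (suc k) Z.* + x) (nCk+nC[k+1]≡[n+1]C[k+1] n k) ⟨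
    w (suc k) Z.* (+ (n C k) Z.+ + (n C suc k))
      ≡⟨ ℤ.*-distribˡ-+ (w (suc k)) (+ (n C k)) (+ (n C suc k)) ⟩
    w (suc k) Z.* + (n C k) Z.+ w (suc k) Z.* + (n C suc k) ∎
  last≡0 : ∑ (suc n) g ≡ ∑ n g
  last≡0 = begin
    ∑ (suc n) g       ≡⟨ ∑-last n g ⟩
    ∑ n g Z.+ g n     ≡⟨ cong (λ x → ∑ n g Z.+ w (suc n) Z.* + x) (k>n⇒nCk≡0 (ℕ.n<1+n n)) ⟩
    ∑ n g Z.+ w (suc n) Z.* 0ℤ ≡⟨ cong (∑ n g Z.+_) (ℤ.*-zeroʳ (w (suc n))) ⟩
    ∑ n g Z.+ 0ℤ      ≡⟨ ℤ.+-identityʳ (∑ n g) ⟩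
    ∑ n g             ∎
  swap : ∀ a b c → a Z.+ (b Z.+ c) ≡ a Z.+ c Z.+ b
  swap = solve 3 (λ a b c → a :+ (b :+ c) := a :+ c :+ b) refl

-- Powers of √s and the components of (1 + √s)ⁿ.

-- √s ^ k = even s k + odd s k · √s

even odd : ℤ → ℕ → ℤ
even s zero    = 1ℤ
even s (suc k) = s Z.* odd s k
odd s zero    = 0ℤ
odd s (suc k) = even s k

even[2j] : ∀ s j → even s (j ℕ.* 2) ≡ s Z.^ j
even[2j] s zero    = refl
even[2j] s (suc j) = cong (s Z.*_) (even[2j] s j)

odd[2j] : ∀ s j → odd s (j ℕ.* 2) ≡ 0ℤ
odd[2j] s zero    = refl
odd[2j] s (suc j) = trans (cong (s Z.*_) (odd[2j] s j)) (ℤ.*-zeroʳ s)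

even[1+2j] : ∀ s j → even s (suc (j ℕ.* 2)) ≡ 0ℤ
even[1+2j] s j = odd[2j] s (suc j)

E O : ℤ → ℕ → ℤ
E s = ∑C (even s)
O s = ∑C (odd s)

-- This and `O-suc` are the two components of multiplication by 1 + √s.
E-suc : ∀ s n → E s (suc n) ≡ E s n Z.+ s Z.* O s n
E-suc s n = trans (∑C-suc (even s) n) (cong (E s n Z.+_) (∑C-* s (odd s) n))

O-suc : ∀ s n → O s (suc n) ≡ O s n Z.+ E s n
O-suc s n = ∑C-suc (odd s) n

-- At s = 1 both recurrences read E + O, so the two claims are proved together and the common value
-- doubles. They start at n = 1, since at n = 0 one has E = 1 but O = 0.
E[1]≡2^ : ∀ n → E 1ℤ (suc n) ≡ + (2 ℕ.^ n)
O[1]≡2^ : ∀ n → O 1ℤ (suc n) ≡ + (2 ℕ.^ n)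
E[1]≡2^ zero = refl
E[1]≡2^ (suc n) = begin
  E 1ℤ (suc (suc n))                    ≡⟨ E-suc 1ℤ (suc n) ⟩
  E 1ℤ (suc n) Z.+ 1ℤ Z.* O 1ℤ (suc n)  ≡⟨ cong (E 1ℤ (suc n) Z.+_) (ℤ.*-identityˡ (O 1ℤ (suc n))) ⟩
  E 1ℤ (suc n) Z.+ O 1ℤ (suc n)         ≡⟨ cong₂ Z._+_ (E[1]≡2^ n) (O[1]≡2^ n) ⟩
  + (2 ℕ.^ n ℕ.+ 2 ℕ.^ n)               ≡⟨ cong (λ x → + (2 ℕ.^ n ℕ.+ x)) (ℕ.+-identityʳ (2 ℕ.^ n)) ⟨
  + (2 ℕ.^ suc n)                       ∎
  where open ≡-Reasoning
O[1]≡2^ zero = refl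
O[1]≡2^ (suc n) = begin
  O 1ℤ (suc (suc n))                    ≡⟨ O-suc 1ℤ (suc n) ⟩
  O 1ℤ (suc n) Z.+ E 1ℤ (suc n)         ≡⟨ cong₂ Z._+_ (O[1]≡2^ n) (E[1]≡2^ n) ⟩
  + (2 ℕ.^ n ℕ.+ 2 ℕ.^ n)               ≡⟨ cong (λ x → + (2 ℕ.^ n ℕ.+ x)) (ℕ.+-identityʳ (2 ℕ.^ n)) ⟨
  + (2 ℕ.^ suc n)                       ∎
  where open ≡-Reasoning

module _ where
  open ≡-Reasoning
  open +-*-Solver

  -- This and `O[-1]-suc²` express (1 + √-1)² = 2√-1, which sends (E, O) to (-2 O, 2 E).
  E[-1]-suc² : ∀ n → E -1ℤ (suc (suc n)) ≡ + 2 Z.* (-1ℤ Z.* O -1ℤ n)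
  E[-1]-suc² n = begin
    E -1ℤ (suc (suc n))
      ≡⟨ E-suc -1ℤ (suc n) ⟩
    E -1ℤ (suc n) Z.+ -1ℤ Z.* O -1ℤ (suc n)
      ≡⟨ cong₂ (λ x y → x Z.+ -1ℤ Z.* y) (E-suc -1ℤ n) (O-suc -1ℤ n) ⟩
    (E -1ℤ n Z.+ -1ℤ Z.* O -1ℤ n) Z.+ -1ℤ Z.* (O -1ℤ n Z.+ E -1ℤ n)
      ≡⟨ solve 2 (λ a b → (a :+ con -1ℤ :* b) :+ con -1ℤ :* (b :+ a) :=
           con (+ 2) :* (con -1ℤ :* b)) refl (E -1ℤ n) (O -1ℤ n) ⟩
    + 2 Z.* (-1ℤ Z.* O -1ℤ n) ∎

  O[-1]-suc² : ∀ n → O -1ℤ (suc (suc n)) ≡ + 2 Z.* E -1ℤ n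
  O[-1]-suc² n = begin
    O -1ℤ (suc (suc n))
      ≡⟨ O-suc -1ℤ (suc n) ⟩
    O -1ℤ (suc n) Z.+ E -1ℤ (suc n)
      ≡⟨ cong₂ Z._+_ (O-suc -1ℤ n) (E-suc -1ℤ n) ⟩
    (O -1ℤ n Z.+ E -1ℤ n) Z.+ (E -1ℤ n Z.+ -1ℤ Z.* O -1ℤ n)
      ≡⟨ solve 2 (λ a b → (b :+ a) :+ (a :+ con -1ℤ :* b) := con (+ 2) :* a)
           refl (E -1ℤ n) (O -1ℤ n) ⟩
    + 2 Z.* E -1ℤ n ∎

  -- Both components are 1 at n = 1, and the map (E, O) ↦ (-2 O, 2 E) turns a ratio O/E = ±1 into
  -- its negative.
  O[-1]≡±E[-1] : ∀ j → O -1ℤ (suc (j ℕ.* 2)) ≡ -1ℤ Z.^ j Z.* E -1ℤ (suc (j ℕ.* 2))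
  O[-1]≡±E[-1] zero = refl
  O[-1]≡±E[-1] (suc j) = begin
    O -1ℤ (suc (suc n))
      ≡⟨ O[-1]-suc² n ⟩
    + 2 Z.* E -1ℤ n
      ≡⟨ solve 1 (λ a → con (+ 2) :* a := con 1ℤ :* (con (+ 2) :* a)) refl (E -1ℤ n) ⟩
    1ℤ Z.* (+ 2 Z.* E -1ℤ n)
      -- Inserting σ² = 1 produces the factor σ E, which the induction hypothesis replaces by O.
      ≡⟨ cong (Z._* (+ 2 Z.* E -1ℤ n)) (-1^n*-1^n j) ⟨
    σ Z.* σ Z.* (+ 2 Z.* E -1ℤ n)
      ≡⟨ solve 2 (λ σ a → σ :* σ :* (con (+ 2) :* a) :=
           (con -1ℤ :* σ) :* (con (+ 2) :* (con -1ℤ :* (σ :* a)))) refl σ (E -1ℤ n) ⟩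
    (-1ℤ Z.* σ) Z.* (+ 2 Z.* (-1ℤ Z.* (σ Z.* E -1ℤ n)))
      ≡⟨ cong (λ x → (-1ℤ Z.* σ) Z.* (+ 2 Z.* (-1ℤ Z.* x))) (O[-1]≡±E[-1] j) ⟨
    (-1ℤ Z.* σ) Z.* (+ 2 Z.* (-1ℤ Z.* O -1ℤ n))
      ≡⟨ cong ((-1ℤ Z.* σ) Z.*_) (E[-1]-suc² n) ⟨
    -1ℤ Z.^ suc j Z.* E -1ℤ (suc (suc n)) ∎
    where
    n = suc (j ℕ.* 2)
    σ = -1ℤ Z.^ j

  -- Raising n by 2 replaces E by -2 O = ∓2 E, so the square gains a factor 4.
  E[-1]²≡2^ : ∀ j → E -1ℤ (suc (j ℕ.* 2)) Z.* E -1ℤ (suc (j ℕ.* 2)) ≡ + (2 ℕ.^ (j ℕ.* 2))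
  E[-1]²≡2^ zero = refl
  E[-1]²≡2^ (suc j) = begin
    E -1ℤ (suc (suc n)) Z.* E -1ℤ (suc (suc n))
      ≡⟨ cong (λ x → x Z.* x) (E[-1]-suc² n) ⟩
    (+ 2 Z.* (-1ℤ Z.* O -1ℤ n)) Z.* (+ 2 Z.* (-1ℤ Z.* O -1ℤ n))
      ≡⟨ cong (λ x → (+ 2 Z.* (-1ℤ Z.* x)) Z.* (+ 2 Z.* (-1ℤ Z.* x))) (O[-1]≡±E[-1] j) ⟩
    (+ 2 Z.* (-1ℤ Z.* (σ Z.* a))) Z.* (+ 2 Z.* (-1ℤ Z.* (σ Z.* a)))
      ≡⟨ solve 2 (λ σ a → (con (+ 2) :* (con -1ℤ :* (σ :* a))) :* (con (+ 2) :* (con -1ℤ :* (σ :* a)))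
           := (σ :* σ) :* (con (+ 2) :* (con (+ 2) :* (a :* a)))) refl σ a ⟩
    (σ Z.* σ) Z.* (+ 2 Z.* (+ 2 Z.* (a Z.* a)))
      ≡⟨ cong₂ (λ x y → x Z.* (+ 2 Z.* (+ 2 Z.* y))) (-1^n*-1^n j) (E[-1]²≡2^ j) ⟩
    1ℤ Z.* (+ 2 Z.* (+ 2 Z.* + (2 ℕ.^ (j ℕ.* 2))))
      ≡⟨ ℤ.*-identityˡ (+ 2 Z.* (+ 2 Z.* + (2 ℕ.^ (j ℕ.* 2)))) ⟩
    + 2 Z.* (+ 2 Z.* + (2 ℕ.^ (j ℕ.* 2)))
      ≡⟨ cong (+ 2 Z.*_) (ℤ.pos-* 2 (2 ℕ.^ (j ℕ.* 2))) ⟨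
    + 2 Z.* + (2 ℕ.* 2 ℕ.^ (j ℕ.* 2))
      ≡⟨ ℤ.pos-* 2 (2 ℕ.* 2 ℕ.^ (j ℕ.* 2)) ⟨
    + (2 ℕ.^ (suc j ℕ.* 2)) ∎
    where
    n = suc (j ℕ.* 2)
    σ = -1ℤ Z.^ j
    a = E -1ℤ n

-- Binomial coefficients modulo a prime p = m + 1.

module OddPrime {m} (pr : Prime (suc m)) where
  private
    p = suc m
    module R = CommutativeRing (ℤ/ p)

  coprime : ∀ {i} → i < m → Coprime (suc i) p
  coprime i<m = coprime-sym (prime⇒coprime pr (s<s i<m))

  -- By absorption p divides (i+1) C(p, i+1), and i + 1 is coprime to p.
  p∣pC[1+i] : ∀ {i} → i < m → p ∣ (p C suc i)
  p∣pC[1+i] {i} i<m = coprime-divisor (coprime-sym (coprime i<m))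
    (divides (m C i) (trans ([1+k]*[1+n]C[1+k]≡[1+n]*nCk m i) (ℕ.*-comm p (m C i))))

  -- The index is shifted: `c i` belongs to k = i + 1. The truncating division is exact for `i < m`,
  -- by `p*c`.
  c : ℕ → ℤ
  c i = + ((p C suc i) / p)

  p*c : ∀ {i} → i < m → + p Z.* c i ≡ + (p C suc i)
  p*c {i} i<m = begin
    + p Z.* c i                 ≡⟨ ℤ.pos-* p ((p C suc i) / p) ⟨
    + (p ℕ.* ((p C suc i) / p)) ≡⟨ cong +_ (ℕ.*-comm p ((p C suc i) / p)) ⟩
    + ((p C suc i) / p ℕ.* p)   ≡⟨ cong +_ (m/n*n≡m (p∣pC[1+i] i<m)) ⟩
    + (p C suc i)               ∎
    where open ≡-Reasoning

  -- The absorption identity with p cancelled in ℤ; it leaves only C(p-1, i) to be found mod p.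
  [1+i]*c : ∀ {i} → i < m → + suc i Z.* c i ≡ + (m C i)
  [1+i]*c {i} i<m = ℤ.*-cancelˡ-≡ (+ p) (+ suc i Z.* c i) (+ (m C i)) (begin
    + p Z.* (+ suc i Z.* c i)   ≡⟨ solve 3 (λ x y z → x :* (y :* z) := y :* (x :* z)) refl
                                     (+ p) (+ suc i) (c i) ⟩
    + suc i Z.* (+ p Z.* c i)   ≡⟨ cong (+ suc i Z.*_) (p*c i<m) ⟩
    + suc i Z.* + (p C suc i)   ≡⟨ ℤ.pos-* (suc i) (p C suc i) ⟨
    + (suc i ℕ.* (p C suc i))   ≡⟨ cong +_ ([1+k]*[1+n]C[1+k]≡[1+n]*nCk m i) ⟩
    + (p ℕ.* (m C i))           ≡⟨ ℤ.pos-* p (m C i) ⟩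
    + p Z.* + (m C i)           ∎)
    where
    open ≡-Reasoning
    open +-*-Solver

  -- Two neighbouring coefficients C(p-1, i) and C(p-1, i+1) add up to C(p, i+1), a multiple of p,
  -- so the sign alternates from C(p-1, 0) = 1.
  mC≡±1 : ∀ {i} → i ≤ m → + (m C i) ≡ -1ℤ Z.^ i mod p
  mC≡±1 {zero} _ = R.refl {1ℤ}
  mC≡±1 {suc i} i<m = subst (+ p ℤ∣.∣_) eq
    (ℤ∣.∣m∣n⇒∣m-n (ℤ∣.∣ᵤ⇒∣ {+ p} {+ (p C suc i)} (p∣pC[1+i] i<m)) (mC≡±1 (ℕ.<⇒≤ i<m)))
    where
    open ≡-Reasoning
    open +-*-Solver
    eq : + (p C suc i) Z.- (+ (m C i) Z.- -1ℤ Z.^ i) ≡ + (m C suc i) Z.- -1ℤ Z.^ suc i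
    eq = begin
      + (p C suc i) Z.- (+ (m C i) Z.- -1ℤ Z.^ i)
        ≡⟨ cong (λ x → + x Z.- (+ (m C i) Z.- -1ℤ Z.^ i)) (nCk+nC[k+1]≡[n+1]C[k+1] m i) ⟨
      (+ (m C i) Z.+ + (m C suc i)) Z.- (+ (m C i) Z.- -1ℤ Z.^ i)
        ≡⟨ solve 3 (λ x y z → (x :+ y) :- (x :- z) := y :- con -1ℤ :* z) refl
             (+ (m C i)) (+ (m C suc i)) (-1ℤ Z.^ i) ⟩
      + (m C suc i) Z.- -1ℤ Z.^ suc i ∎

  ±recip≡c : ∀ {i} → i < m → -1ℤ Z.^ i Z.* recip p (suc i) ≡ c i mod p
  ±recip≡c {i} i<m = begin
    -1ℤ Z.^ i Z.* r          ≈⟨ R.*-congʳ {r} {+ (m C i)} { -1ℤ Z.^ i} (mC≡±1 (ℕ.<⇒≤ i<m)) ⟨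
    + (m C i) Z.* r          ≡⟨ cong (Z._* r) ([1+i]*c i<m) ⟨
    + suc i Z.* c i Z.* r    ≡⟨ solve 3 (λ x y z → x :* y :* z := x :* z :* y) refl (+ suc i) (c i) r ⟩
    + suc i Z.* r Z.* c i    ≈⟨ R.*-congʳ {c i} {+ suc i Z.* r} {1ℤ} (recip-inverse {p} {suc i} (coprime i<m)) ⟩
    1ℤ Z.* c i               ≡⟨ ℤ.*-identityˡ (c i) ⟩
    c i                      ∎
    where
    open import Relation.Binary.Reasoning.Setoid R.setoid
    open +-*-Solver
    r = recip p (suc i)

  ∑c : (ℕ → ℤ) → ℤ
  ∑c w = ∑ m (λ i → w (suc i) Z.* c i)

  -- The terms of `∑C w p` with 0 < k < p are p times those of `∑c w`; what remains are the end
  -- terms k = 0 and k = p, both with coefficient 1.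
  p*∑c : ∀ w → + p Z.* ∑c w ≡ ∑C w p Z.- w 0 Z.- w p
  p*∑c w = begin
    + p Z.* ∑c w
      ≡⟨ ∑-* m (+ p) (λ i → w (suc i) Z.* c i) ⟨
    ∑ m (λ i → + p Z.* (w (suc i) Z.* c i))
      ≡⟨ ∑-cong m middle ⟩
    M
      ≡⟨ solve 3 (λ a b x → x := a :* con 1ℤ :+ (x :+ b :* con 1ℤ) :- a :- b) refl (w 0) (w p) M ⟩
    w 0 Z.* 1ℤ Z.+ (M Z.+ w p Z.* 1ℤ) Z.- w 0 Z.- w p
      ≡⟨ cong (λ x → w 0 Z.* 1ℤ Z.+ (M Z.+ w p Z.* + x) Z.- w 0 Z.- w p) (nCn≡1 p) ⟨
    w 0 Z.* 1ℤ Z.+ (M Z.+ w p Z.* + (p C p)) Z.- w 0 Z.- w p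
      ≡⟨ cong (λ x → w 0 Z.* 1ℤ Z.+ x Z.- w 0 Z.- w p) (∑-last m (λ i → w (suc i) Z.* + (p C suc i))) ⟨
    ∑C w p Z.- w 0 Z.- w p ∎
    where
    open ≡-Reasoning
    open +-*-Solver
    M = ∑ m (λ i → w (suc i) Z.* + (p C suc i))
    middle : ∀ {i} → i < m → + p Z.* (w (suc i) Z.* c i) ≡ w (suc i) Z.* + (p C suc i)
    middle {i} i<m = trans
      (solve 3 (λ x y z → x :* (y :* z) := y :* (x :* z)) refl (+ p) (w (suc i)) (c i))
      (cong (w (suc i) Z.*_) (p*c i<m))

  -- From sums of reciprocals to sums of C(p,k)/p.

  ∑<≡∑c : ∀ {P : Pred ℕ 0ℓ} (P? : Decidable P) a w f →
          (∀ i → P (suc i) → f (suc i) ≡ a Z.* (w (suc i) Z.* (-1ℤ Z.^ i Z.* recip p (suc i)))) →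
          (∀ i → ¬ P (suc i) → w (suc i) ≡ 0ℤ) →
          ∑< p P? f ≡ a Z.* ∑c w mod p
  ∑<≡∑c P? a w f on off =
    subst (λ x → ∑< p P? f ≡ x mod p) (∑-* m a (λ i → w (suc i) Z.* c i))
      (∑-filter P? p f (λ i → a Z.* (w (suc i) Z.* c i)) suc m on′ off′)
    where
    on′ : ∀ {i} → i < m → _ → f (suc i) ≡ a Z.* (w (suc i) Z.* c i) mod p
    on′ {i} i<m Pi = subst (λ x → x ≡ a Z.* (w (suc i) Z.* c i) mod p) (sym (on i Pi))
      (R.*-congˡ {a} {w (suc i) Z.* ±r} {w (suc i) Z.* c i}
        (R.*-congˡ {w (suc i)} {±r} {c i} (±recip≡c i<m)))
      where ±r = -1ℤ Z.^ i Z.* recip p (suc i)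
    off′ : ∀ i → ¬ _ → a Z.* (w (suc i) Z.* c i) ≡ 0ℤ
    off′ i ¬Pi = trans (cong (λ x → a Z.* (x Z.* c i)) (off i ¬Pi)) (ℤ.*-zeroʳ a)

  -- For even k the exponent k - 1 is odd; the factor `-1ℤ` in front compensates the sign in
  -- `±recip≡c`.
  ∑<-even : ∀ s f → (∀ j → f (j ℕ.* 2) ≡ s Z.^ j Z.* recip p (j ℕ.* 2)) →
            ∑< p 2∣? f ≡ -1ℤ Z.* ∑c (even s) mod p
  ∑<-even s f eq = ∑<≡∑c 2∣? -1ℤ (even s) f on off
    where
    open ≡-Reasoning
    open +-*-Solver
    on : ∀ i → 2 ∣ suc i →
         f (suc i) ≡ -1ℤ Z.* (even s (suc i) Z.* (-1ℤ Z.^ i Z.* recip p (suc i)))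
    on _ (divides (suc j) refl) = begin
      f (suc j ℕ.* 2)
        ≡⟨ eq (suc j) ⟩
      s Z.^ suc j Z.* r
        ≡⟨ solve 2 (λ x r → x :* r := con -1ℤ :* (x :* (con -1ℤ :* con 1ℤ :* r))) refl (s Z.^ suc j) r ⟩
      -1ℤ Z.* (s Z.^ suc j Z.* (-1ℤ Z.* 1ℤ Z.* r))
        ≡⟨ cong₂ (λ x y → -1ℤ Z.* (x Z.* (-1ℤ Z.* y Z.* r))) (even[2j] s (suc j)) (-1^even j) ⟨
      -1ℤ Z.* (even s (suc j ℕ.* 2) Z.* (-1ℤ Z.^ suc (j ℕ.* 2) Z.* r)) ∎
      where r = recip p (suc j ℕ.* 2)
    off : ∀ i → ¬ 2 ∣ suc i → even s (suc i) ≡ 0ℤ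
    off i 2∤ with 2∤⇒odd (suc i) 2∤
    ... | j , refl = even[1+2j] s j

  -- For odd k the sign in `±recip≡c` is +1. The scalar `a` allows for the exponent (k+1)/2 of the
  -- alternating sum, one more than the exponent (k-1)/2 in `odd s k`.
  ∑<-odd : ∀ a s f → (∀ j → f (suc (j ℕ.* 2)) ≡ a Z.* (s Z.^ j Z.* recip p (suc (j ℕ.* 2)))) →
           ∑< p (¬? ∘ 2∣?) f ≡ a Z.* ∑c (odd s) mod p
  ∑<-odd a s f eq = ∑<≡∑c (¬? ∘ 2∣?) a (odd s) f on off
    where
    open ≡-Reasoning
    on : ∀ i → ¬ 2 ∣ suc i →
         f (suc i) ≡ a Z.* (odd s (suc i) Z.* (-1ℤ Z.^ i Z.* recip p (suc i)))
    on i 2∤ with 2∤⇒odd (suc i) 2∤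
    ... | j , refl = begin
      f (suc (j ℕ.* 2))
        ≡⟨ eq j ⟩
      a Z.* (s Z.^ j Z.* r)
        ≡⟨ cong (λ x → a Z.* (s Z.^ j Z.* x)) (ℤ.*-identityˡ r) ⟨
      a Z.* (s Z.^ j Z.* (1ℤ Z.* r))
        ≡⟨ cong₂ (λ x y → a Z.* (x Z.* (y Z.* r))) (even[2j] s j) (-1^even j) ⟨
      a Z.* (odd s (suc (j ℕ.* 2)) Z.* (-1ℤ Z.^ (j ℕ.* 2) Z.* r)) ∎
      where r = recip p (suc (j ℕ.* 2))
    off : ∀ i → ¬ ¬ 2 ∣ suc i → odd s (suc i) ≡ 0ℤ
    off i ¬2∤ with 2∣? (suc i)
    ... | yes (divides j eq) = trans (cong (odd s) eq) (odd[2j] s j)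
    ... | no 2∤ = contradiction 2∤ ¬2∤

2-coprime : ∀ j → Prime (suc (j ℕ.* 2)) → Coprime 2 (suc (j ℕ.* 2))
2-coprime zero    pr = contradiction pr ¬prime[1]
2-coprime (suc j) pr = OddPrime.coprime pr (s<s z<s)

-- The Fermat quotient at an odd prime p = 2j + 1.

module _ (j : ℕ) (pr : Prime (suc (j ℕ.* 2))) where
  open OddPrime pr
  private
    m = j ℕ.* 2
    p = suc m
    module R = CommutativeRing (ℤ/ p)
    Q = (2 ℕ.^ m ℕ.∸ 1) / p
    h = recip p 2
    σ = -1ℤ Z.^ j
    r = ∑c (even -1ℤ)

  2^m∸1 : + (2 ℕ.^ m ℕ.∸ 1) ≡ + (2 ℕ.^ m) Z.- 1ℤ
  2^m∸1 = trans (sym (ℤ.⊖-≥ (ℕ.m^n>0 2 m))) (sym (ℤ.m-n≡m⊖n (2 ℕ.^ m) 1))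

  -- As p is odd, the weight `even` keeps only the end term at k = 0; in `p*∑c-odd` only the one at
  -- k = p survives. Either way exactly 1 is subtracted from 2^(p-1).
  p*∑c-even : + p Z.* ∑c (even 1ℤ) ≡ + (2 ℕ.^ m ℕ.∸ 1)
  p*∑c-even = begin
    + p Z.* ∑c (even 1ℤ)               ≡⟨ p*∑c (even 1ℤ) ⟩
    E 1ℤ p Z.- 1ℤ Z.- even 1ℤ p        ≡⟨ cong₂ (λ x y → x Z.- 1ℤ Z.- y) (E[1]≡2^ m) (even[1+2j] 1ℤ j) ⟩
    + (2 ℕ.^ m) Z.- 1ℤ Z.- 0ℤ          ≡⟨ ℤ.+-identityʳ (+ (2 ℕ.^ m) Z.- 1ℤ) ⟩
    + (2 ℕ.^ m) Z.- 1ℤ                 ≡⟨ 2^m∸1 ⟨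
    + (2 ℕ.^ m ℕ.∸ 1)                  ∎
    where open ≡-Reasoning

  p*∑c-odd : + p Z.* ∑c (odd 1ℤ) ≡ + (2 ℕ.^ m ℕ.∸ 1)
  p*∑c-odd = begin
    + p Z.* ∑c (odd 1ℤ)                ≡⟨ p*∑c (odd 1ℤ) ⟩
    O 1ℤ p Z.- 0ℤ Z.- odd 1ℤ p         ≡⟨ cong₂ (λ x y → x Z.- 0ℤ Z.- y) (O[1]≡2^ m)
                                            (trans (even[2j] 1ℤ j) (ℤ.^-zeroˡ j)) ⟩
    + (2 ℕ.^ m) Z.- 0ℤ Z.- 1ℤ          ≡⟨ cong (Z._- 1ℤ) (ℤ.+-identityʳ (+ (2 ℕ.^ m))) ⟩
    + (2 ℕ.^ m) Z.- 1ℤ                 ≡⟨ 2^m∸1 ⟨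
    + (2 ℕ.^ m ℕ.∸ 1)                  ∎
    where open ≡-Reasoning

  -- The division defining `Q` is exact: `p*∑c-even` already displays 2^(p-1) - 1 as a multiple of
  -- p, which is Fermat's little theorem for base 2.
  p*Q : + p Z.* + Q ≡ + (2 ℕ.^ m ℕ.∸ 1)
  p*Q = begin
    + p Z.* + Q       ≡⟨ ℤ.pos-* p Q ⟨
    + (p ℕ.* Q)       ≡⟨ cong +_ (ℕ.*-comm p Q) ⟩
    + (Q ℕ.* p)       ≡⟨ cong +_ (m/n*n≡m p∣2^m∸1) ⟩
    + (2 ℕ.^ m ℕ.∸ 1) ∎
    where
    open ≡-Reasoning
    p∣2^m∸1 : p ∣ 2 ℕ.^ m ℕ.∸ 1
    p∣2^m∸1 = ℤ∣.∣⇒∣ᵤ {+ p} {+ (2 ℕ.^ m ℕ.∸ 1)}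
      (ℤ∣.divides (∑c (even 1ℤ)) (trans (sym p*∑c-even) (ℤ.*-comm (+ p) (∑c (even 1ℤ)))))

  ∑c-even≡Q : ∑c (even 1ℤ) ≡ + Q
  ∑c-even≡Q = ℤ.*-cancelˡ-≡ (+ p) (∑c (even 1ℤ)) (+ Q) (trans p*∑c-even (sym p*Q))

  ∑c-odd≡Q : ∑c (odd 1ℤ) ≡ + Q
  ∑c-odd≡Q = ℤ.*-cancelˡ-≡ (+ p) (∑c (odd 1ℤ)) (+ Q) (trans p*∑c-odd (sym p*Q))

  p*r : + p Z.* r ≡ E -1ℤ p Z.- 1ℤ
  p*r = begin
    + p Z.* r                          ≡⟨ p*∑c (even -1ℤ) ⟩
    E -1ℤ p Z.- 1ℤ Z.- even -1ℤ p      ≡⟨ cong (λ x → E -1ℤ p Z.- 1ℤ Z.- x) (even[1+2j] -1ℤ j) ⟩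
    E -1ℤ p Z.- 1ℤ Z.- 0ℤ              ≡⟨ ℤ.+-identityʳ (E -1ℤ p Z.- 1ℤ) ⟩
    E -1ℤ p Z.- 1ℤ                     ∎
    where open ≡-Reasoning

  module _ where
    open ≡-Reasoning
    open +-*-Solver

    -- The end term at k = p is (-1)^j = σ and O = σ E, so O - σ = σ (E - 1) = σ p r.
    ∑c-odd≡σr : ∑c (odd -1ℤ) ≡ σ Z.* r
    ∑c-odd≡σr = ℤ.*-cancelˡ-≡ (+ p) (∑c (odd -1ℤ)) (σ Z.* r) (begin
      + p Z.* ∑c (odd -1ℤ)
        ≡⟨ p*∑c (odd -1ℤ) ⟩
      O -1ℤ p Z.- 0ℤ Z.- odd -1ℤ p
        ≡⟨ cong₂ (λ x y → x Z.- 0ℤ Z.- y) (O[-1]≡±E[-1] j) (even[2j] -1ℤ j) ⟩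
      σ Z.* E -1ℤ p Z.- 0ℤ Z.- σ
        ≡⟨ solve 2 (λ s a → s :* a :- con 0ℤ :- s := s :* (a :- con 1ℤ)) refl σ (E -1ℤ p) ⟩
      σ Z.* (E -1ℤ p Z.- 1ℤ)
        ≡⟨ cong (σ Z.*_) p*r ⟨
      σ Z.* (+ p Z.* r)
        ≡⟨ solve 3 (λ x y z → y :* (x :* z) := x :* (y :* z)) refl (+ p) σ r ⟩
      + p Z.* (σ Z.* r) ∎)

    -- Squaring E = 1 + p r gives 2^(p-1) = 1 + 2 p r + p² r²; then 1 is subtracted and p cancelled.
    Q≡2r+pr² : + Q ≡ + 2 Z.* r Z.+ + p Z.* (r Z.* r)
    Q≡2r+pr² = ℤ.*-cancelˡ-≡ (+ p) (+ Q) (+ 2 Z.* r Z.+ + p Z.* (r Z.* r)) (begin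
      + p Z.* + Q
        ≡⟨ trans p*Q 2^m∸1 ⟩
      + (2 ℕ.^ m) Z.- 1ℤ
        ≡⟨ cong (Z._- 1ℤ) (E[-1]²≡2^ j) ⟨
      a Z.* a Z.- 1ℤ
        ≡⟨ solve 1 (λ a → a :* a :- con 1ℤ :=
             con (+ 2) :* (a :- con 1ℤ) :+ (a :- con 1ℤ) :* (a :- con 1ℤ)) refl a ⟩
      + 2 Z.* (a Z.- 1ℤ) Z.+ (a Z.- 1ℤ) Z.* (a Z.- 1ℤ)
        ≡⟨ cong (λ x → + 2 Z.* x Z.+ x Z.* x) p*r ⟨
      + 2 Z.* (+ p Z.* r) Z.+ (+ p Z.* r) Z.* (+ p Z.* r)
        ≡⟨ solve 2 (λ p r → con (+ 2) :* (p :* r) :+ (p :* r) :* (p :* r) :=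
             p :* (con (+ 2) :* r :+ p :* (r :* r))) refl (+ p) r ⟩
      + p Z.* (+ 2 Z.* r Z.+ + p Z.* (r Z.* r)) ∎)
      where a = E -1ℤ p

  r≡Q/2 : r ≡ h Z.* + Q mod p
  r≡Q/2 = begin
    r                                             ≡⟨ ℤ.*-identityˡ r ⟨
    1ℤ Z.* r                                      ≈⟨ R.*-congʳ {r} {+ 2 Z.* h} {1ℤ}
                                                       (recip-inverse {p} {2} (2-coprime j pr)) ⟨
    -- The quotient comes from 2hr - h(2r + pr²) = -(hr²)p.
    + 2 Z.* h Z.* r                               ≈⟨ ℤ∣.divides (Z.- (h Z.* (r Z.* r))) (
      solve 3 (λ p h r → con (+ 2) :* h :* r :- h :* (con (+ 2) :* r :+ p :* (r :* r)) :=
        (:- (h :* (r :* r))) :* p) refl (+ p) h r) ⟩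
    h Z.* (+ 2 Z.* r Z.+ + p Z.* (r Z.* r))       ≡⟨ cong (h Z.*_) Q≡2r+pr² ⟨
    h Z.* + Q                                     ∎
    where
    open import Relation.Binary.Reasoning.Setoid R.setoid
    open +-*-Solver

  -- The four sums modulo p.

  ∑<-even-1 : ∑< p 2∣? (recip p) ≡ Z.- + Q mod p
  ∑<-even-1 = subst (λ x → ∑< p 2∣? (recip p) ≡ x mod p)
    (trans (cong (-1ℤ Z.*_) ∑c-even≡Q) (ℤ.-1*i≡-i (+ Q)))
    (∑<-even 1ℤ (recip p) (λ i → sym
      (trans (cong (Z._* recip p (i ℕ.* 2)) (ℤ.^-zeroˡ i)) (ℤ.*-identityˡ (recip p (i ℕ.* 2))))))

  ∑<-odd-1 : ∑< p (¬? ∘ 2∣?) (recip p) ≡ + Q mod p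
  ∑<-odd-1 = subst (λ x → ∑< p (¬? ∘ 2∣?) (recip p) ≡ x mod p)
    (trans (cong (1ℤ Z.*_) ∑c-odd≡Q) (ℤ.*-identityˡ (+ Q)))
    (∑<-odd 1ℤ 1ℤ (recip p) (λ i → sym
      (trans (ℤ.*-identityˡ (1ℤ Z.^ i Z.* ρ i))
        (trans (cong (Z._* ρ i) (ℤ.^-zeroˡ i)) (ℤ.*-identityˡ (ρ i))))))
    where ρ = λ i → recip p (suc (i ℕ.* 2))

  -- The factor `-1ℤ Z.* h` is the component at p of `fromℚ (-ℚ ½)`: numerator -1 times the
  -- reciprocal of 2.
  ∑<-even-1̄ : ∑< p 2∣? (λ k → -1ℤ Z.^ (k / 2) Z.* recip p k) ≡ -1ℤ Z.* h Z.* + Q mod p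
  ∑<-even-1̄ = begin
    ∑< p 2∣? f              ≈⟨ ∑<-even -1ℤ f (λ i →
                                 cong (λ n → -1ℤ Z.^ n Z.* recip p (i ℕ.* 2)) (m*n/n≡m i 2)) ⟩
    -1ℤ Z.* r               ≈⟨ R.*-congˡ { -1ℤ} {r} {h Z.* + Q} r≡Q/2 ⟩
    -1ℤ Z.* (h Z.* + Q)     ≡⟨ ℤ.*-assoc -1ℤ h (+ Q) ⟨
    -1ℤ Z.* h Z.* + Q       ∎
    where
    open import Relation.Binary.Reasoning.Setoid R.setoid
    f = λ k → -1ℤ Z.^ (k / 2) Z.* recip p k

  ∑<-odd-1̄ : ∑< p (¬? ∘ 2∣?) (λ k → -1ℤ Z.^ (suc k / 2) Z.* recip p k) ≡
             -1ℤ Z.* h Z.* -1ℤ Z.^ (m / 2) Z.* + Q mod p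
  ∑<-odd-1̄ = begin
    -- At k = 2i + 1 the exponent (k+1)/2 is i + 1; its extra factor -1 is the scalar passed to
    -- `∑<-odd`.
    ∑< p (¬? ∘ 2∣?) f                       ≈⟨ ∑<-odd -1ℤ -1ℤ f (λ i → trans
      (cong (λ n → -1ℤ Z.^ n Z.* ρ i) (m*n/n≡m (suc i) 2))
      (ℤ.*-assoc -1ℤ (-1ℤ Z.^ i) (ρ i))) ⟩
    -1ℤ Z.* ∑c (odd -1ℤ)                    ≡⟨ cong (-1ℤ Z.*_) ∑c-odd≡σr ⟩
    -1ℤ Z.* (σ Z.* r)                       ≡⟨ ℤ.*-assoc -1ℤ σ r ⟨
    -1ℤ Z.* σ Z.* r                         ≈⟨ R.*-congˡ { -1ℤ Z.* σ} {r} {h Z.* + Q} r≡Q/2 ⟩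
    -1ℤ Z.* σ Z.* (h Z.* + Q)               ≡⟨ solve 3 (λ s h q →
      con -1ℤ :* s :* (h :* q) := con -1ℤ :* h :* s :* q) refl σ h (+ Q) ⟩
    -1ℤ Z.* h Z.* σ Z.* + Q                 ≡⟨ cong (λ n → -1ℤ Z.* h Z.* -1ℤ Z.^ n Z.* + Q) (m*n/n≡m j 2) ⟨
    -1ℤ Z.* h Z.* -1ℤ Z.^ (m / 2) Z.* + Q   ∎
    where
    open import Relation.Binary.Reasoning.Setoid R.setoid
    open +-*-Solver
    f = λ k → -1ℤ Z.^ (suc k / 2) Z.* recip p k
    ρ = λ i → recip p (suc (i ℕ.* 2))

-- Passage from odd primes to 𝒜.

oddPrime : ∀ {p} → Prime p → p ≢ 2 → ∃ λ j → p ≡ suc (j ℕ.* 2)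
oddPrime {p} pr p≢2 = 2∤⇒odd p 2∤p
  where
  2∤p : ¬ 2 ∣ p
  2∤p 2∣p with prime⇒irreducible pr 2∣p
  ... | inj₂ refl = p≢2 refl

-- The finite exceptional list in 𝒜 is just the prime 2.
≈-fromOddPrimes : ∀ {x y} →
  (∀ j (pr : Prime (suc (j ℕ.* 2))) →
    x (suc (j ℕ.* 2) , [ pr ]) ≡ y (suc (j ℕ.* 2) , [ pr ]) mod suc (j ℕ.* 2)) →
  x ≈ y
≈-fromOddPrimes {x} {y} x≡y = 2 ∷ [] , agree
  where
  agree : ∀ p → value p ∉ 2 ∷ [] → x p ≡ y p mod value p
  -- The primality proof stored in 𝒫 is irrelevant; deciding primality recovers a usable one.
  agree (p , [ pr ]) p∉ with oddPrime (recompute (prime? p) pr) (p∉ ∘ here)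
  ... | j , refl = x≡y j (recompute (prime? p) pr)

proposition3p1 : (S[1] ≈ ζ⁽²⁾[1] × ζ⁽²⁾[1] ≈ - q₂)
    × (ζ⁽²⁾[1̄] ≈ S[1̄] × S[1̄] ≈ fromℚ (-ℚ ½) * q₂)
    × (t[1] ≈ T[1] × T[1] ≈ q₂)
    × (t[1̄] ≈ T[1̄] × T[1̄] ≈ fromℚ (-ℚ ½) * [-1]^p′ * q₂)
proposition3p1 =
    (A.refl {S[1]} , ≈-fromOddPrimes {ζ⁽²⁾[1]} { - q₂} ∑<-even-1)
  , (A.refl {S[1̄]} , ≈-fromOddPrimes {S[1̄]} {fromℚ (-ℚ ½) * q₂} ∑<-even-1̄)
  , (A.refl {T[1]} , ≈-fromOddPrimes {T[1]} {q₂} ∑<-odd-1)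
  , (A.refl {T[1̄]} , ≈-fromOddPrimes {T[1̄]} {fromℚ (-ℚ ½) * [-1]^p′ * q₂} ∑<-odd-1̄)
  where module A = CommutativeRing 𝒜
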